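{- Let $N$ be a finite set with $|N|\geq 3$. If $\mathcal{B}$ is a min-balanced set system on $N$ such that $|\mathcal{B}|\geq 3$ and $Z\in\mathcal{B}$, then $Y:=N\setminus Z$ is not in $\mathcal{B}$, the set system $\mathcal{S}:=(\mathcal{B}\setminus\{Z\})\cup\{Y\}$ is purely min-semi-balanced on $N$, and $Y$ is the exceptional set within $\mathcal{S}$. Conversely, if $\mathcal{S}$ is a (purely) min-semi-balanced system on $N$ and $Y\in\mathcal{S}$ is the exceptional set within $\mathcal{S}$, then $Z:=N\setminus Y$ is not in $\mathcal{S}$ and $\mathcal{B}:=(\mathcal{S}\setminus\{Y\})\cup\{Z\}$ is a min-balanced system on $N$ such that $|\mathcal{B}|\geq 3$.
   Context: $\mathcal{P}(N)$ is the power set of $N$, $\subset$ is strict inclusion, and $\chi_S\in\mathbb{R}^N$ is the incidence vector of $S\subseteq N$. A constant vector in $\mathbb{R}^N$ is a vector $[r,\ldots,r]$, $r\in\mathbb{R}$. A linear combination is conic if all coefficients are $\geq 0$, and semi-conic if at most one coefficient is strictly negative. A non-trivial set system on $N$ is a system $\mathcal{S}$ with $\emptyset\neq\mathcal{S}\subseteq\mathcal{P}(N)\setminus\{\emptyset,N\}$. It is balanced (on $N$) if $\chi_N$ is a conic combination of $\{\chi_S:S\in\mathcal{S}\}$ with all coefficients non-zero. It is semi-balanced (on $N$) if some constant vector in $\mathbb{R}^N$ is a semi-conic combination of $\{\chi_S:S\in\mathcal{S}\}$ with all coefficients non-zero. It is min-balanced (min-semi-balanced) if it is balanced (semi-balanced)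 and has no strict subsystem that is balanced (semi-balanced) on $N$. It is purely min-semi-balanced if it is min-semi-balanced and not balanced. A set $T\in\mathcal{S}$ is exceptional within $\mathcal{S}$ if there is a linear combination $\sum_{S\in\mathcal{S}}\lambda_S\chi_S$ yielding a constant vector in $\mathbb{R}^N$ with $\lambda_T<0$ and $\lambda_S\geq 0$ for $S\in\mathcal{S}\setminus\{T\}$. A purely min-semi-balanced system has exactly one exceptional set. -}

module Defs where

open import Level using (Level; 0ℓ; _⊔_) renaming (suc to lsuc)
open import Algebra.Core using (Op₁; Op₂)
open import Algebra.Structures using (IsCommutativeRing)
open import Data.Bool.Base using (if_then_else_)
import Data.Bool.Properties as Bool
open import Data.Fin.Base using (Fin)
open import Data.Fin.Subset using (Subset; inside; outside; ⊥; ⊤)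
open import Data.List.Base using (List; []; _∷_; _++_; map; filter; foldr; length)
open import Data.Nat.Base using (ℕ; zero; suc)
open import Data.Product.Base using (∃; _×_)
import Data.Vec.Base as Vec
open import Data.Vec.Functional using (Vector; replicate)
open import Data.Vec.Properties using (≡-dec)
open import Relation.Binary.Core using (Rel)
open import Relation.Binary.Definitions using (DecidableEquality)
open import Relation.Binary.PropositionalEquality.Core using (_≡_)
open import Relation.Binary.Structures using (IsStrictTotalOrder)
import Relation.Binary.Construct.StrictToNonStrict as StrictToNonStrict
open import Relation.Nullary.Negation.Core using (¬_)
open import Relation.Unary using (Pred; Decidable)
import Relation.Unary as U
open import Relation.Unary.Properties using (∁?; _∩?_; _∪?_)

-- The standard library has no real numbers.  Coefficients are taken in an
-- arbitrary linearly ordered field whose order satisfies trichotomy; read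
-- classically, ℝ is an instance.

record OrderedField (c ℓ₁ ℓ₂ : Level) : Set (lsuc (c ⊔ ℓ₁ ⊔ ℓ₂)) where
  infix  8 -_
  infixl 7 _*_
  infixl 6 _+_
  infix  4 _≈_ _<_
  field
    Carrier            : Set c
    _≈_                : Rel Carrier ℓ₁
    _<_                : Rel Carrier ℓ₂
    _+_ _*_            : Op₂ Carrier
    -_                 : Op₁ Carrier
    0# 1#              : Carrier
    isCommutativeRing  : IsCommutativeRing _≈_ _+_ _*_ -_ 0# 1#
    isStrictTotalOrder : IsStrictTotalOrder _≈_ _<_
    1≉0                : ¬ (1# ≈ 0#)
    inverse            : ∀ x → ¬ (x ≈ 0#) → ∃ λ y → x * y ≈ 1#
    +-monoˡ-<          : ∀ z {x y} → x < y → x + z < y + z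
    *-pos              : ∀ {x y} → 0# < x → 0# < y → 0# < x * y

  open StrictToNonStrict _≈_ _<_ public using (_≤_)

-- The ground set N is Fin n, so that Subset n is 𝒫(N), with ⊥ = ∅ and ⊤ = N.

_≟ˢ_ : ∀ {n} → DecidableEquality (Subset n)
_≟ˢ_ = ≡-dec Bool._≟_

-- Every subset of Fin n, each listed once.
subsets : ∀ n → List (Subset n)
subsets zero    = Vec.[] ∷ []
subsets (suc n) = map (inside Vec.∷_) (subsets n) ++ map (outside Vec.∷_) (subsets n)

-- Membership is decidable because a set system is a finite set of subsets,
-- over which one sums.
record SetSystem (n : ℕ) : Set₁ where
  field
    Member  : Pred (Subset n) 0ℓ
    member? : Decidable Member

open SetSystem public

infix  4 _∈ˢ_ _∉ˢ_ _⊂ˢ_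
infixl 6 _∪ˢ_ _∖ˢ_

_∈ˢ_ _∉ˢ_ : ∀ {n} → Subset n → SetSystem n → Set
S ∈ˢ 𝒮 = Member 𝒮 S
S ∉ˢ 𝒮 = ¬ (S ∈ˢ 𝒮)

_⊂ˢ_ : ∀ {n} → SetSystem n → SetSystem n → Set
𝒯 ⊂ˢ 𝒮 = Member 𝒯 U.⊂ Member 𝒮

｛_｝ˢ : ∀ {n} → Subset n → SetSystem n
｛ S ｝ˢ .Member  = U.｛ S ｝
｛ S ｝ˢ .member? = S ≟ˢ_

_∪ˢ_ _∖ˢ_ : ∀ {n} → SetSystem n → SetSystem n → SetSystem n
(𝒮 ∪ˢ 𝒯) .Member  = Member 𝒮 U.∪ Member 𝒯
(𝒮 ∪ˢ 𝒯) .member? = member? 𝒮 ∪? member? 𝒯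
(𝒮 ∖ˢ 𝒯) .Member  = Member 𝒮 U.∖ Member 𝒯
(𝒮 ∖ˢ 𝒯) .member? = member? 𝒮 ∩? ∁? (member? 𝒯)

members : ∀ {n} → SetSystem n → List (Subset n)
members {n} 𝒮 = filter (member? 𝒮) (subsets n)

∣_∣ˢ : ∀ {n} → SetSystem n → ℕ
∣ 𝒮 ∣ˢ = length (members 𝒮)

NonTrivial : ∀ {n} → SetSystem n → Set
NonTrivial 𝒮 = (∃ λ S → S ∈ˢ 𝒮) × ⊥ ∉ˢ 𝒮 × ⊤ ∉ˢ 𝒮

module _ {c ℓ₁ ℓ₂} (K : OrderedField c ℓ₁ ℓ₂) where
  open OrderedField K

  private variable n : ℕ

  χ : Subset n → Vector Carrier n
  χ S i = if Vec.lookup S i then 1# else 0#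

  -- Only the values of the coefficient function on members of 𝒮 matter.
  linComb : SetSystem n → (Subset n → Carrier) → Vector Carrier n
  linComb 𝒮 coef i = foldr (λ S acc → coef S * χ S i + acc) 0# (members 𝒮)

  _≈ᵛ_ : Rel (Vector Carrier n) ℓ₁
  v ≈ᵛ w = ∀ i → v i ≈ w i

  IsConstant : Vector Carrier n → Set (c ⊔ ℓ₁)
  IsConstant {n} v = ∃ λ r → v ≈ᵛ replicate n r

  Conic : SetSystem n → (Subset n → Carrier) → Set (ℓ₁ ⊔ ℓ₂)
  Conic 𝒮 coef = ∀ S → S ∈ˢ 𝒮 → 0# ≤ coef S

  SemiConic : SetSystem n → (Subset n → Carrier) → Set ℓ₂
  SemiConic 𝒮 coef = ∀ S T → S ∈ˢ 𝒮 → T ∈ˢ 𝒮 → coef S < 0# → coef T < 0# → S ≡ T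

  AllNonZero : SetSystem n → (Subset n → Carrier) → Set ℓ₁
  AllNonZero 𝒮 coef = ∀ S → S ∈ˢ 𝒮 → ¬ (coef S ≈ 0#)

  Balanced : SetSystem n → Set (c ⊔ ℓ₁ ⊔ ℓ₂)
  Balanced 𝒮 = NonTrivial 𝒮 ×
    ∃ λ coef → Conic 𝒮 coef × AllNonZero 𝒮 coef × linComb 𝒮 coef ≈ᵛ χ ⊤

  SemiBalanced : SetSystem n → Set (c ⊔ ℓ₁ ⊔ ℓ₂)
  SemiBalanced 𝒮 = NonTrivial 𝒮 ×
    ∃ λ coef → SemiConic 𝒮 coef × AllNonZero 𝒮 coef × IsConstant (linComb 𝒮 coef)

  MinBalanced : SetSystem n → Set (lsuc 0ℓ ⊔ c ⊔ ℓ₁ ⊔ ℓ₂)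
  MinBalanced 𝒮 = Balanced 𝒮 × (∀ 𝒯 → 𝒯 ⊂ˢ 𝒮 → ¬ Balanced 𝒯)

  MinSemiBalanced : SetSystem n → Set (lsuc 0ℓ ⊔ c ⊔ ℓ₁ ⊔ ℓ₂)
  MinSemiBalanced 𝒮 = SemiBalanced 𝒮 × (∀ 𝒯 → 𝒯 ⊂ˢ 𝒮 → ¬ SemiBalanced 𝒯)

  PurelyMinSemiBalanced : SetSystem n → Set (lsuc 0ℓ ⊔ c ⊔ ℓ₁ ⊔ ℓ₂)
  PurelyMinSemiBalanced 𝒮 = MinSemiBalanced 𝒮 × ¬ Balanced 𝒮

  Exceptional : SetSystem n → Subset n → Set (c ⊔ ℓ₁ ⊔ ℓ₂)
  Exceptional 𝒮 T = T ∈ˢ 𝒮 ×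
    ∃ λ coef → IsConstant (linComb 𝒮 coef)
             × coef T < 0#
             × (∀ S → S ∈ˢ 𝒮 → ¬ (S ≡ T) → 0# ≤ coef S)

  UniqueExceptional : SetSystem n → Subset n → Set (c ⊔ ℓ₁ ⊔ ℓ₂)
  UniqueExceptional 𝒮 Y = Exceptional 𝒮 Y × (∀ T → Exceptional 𝒮 T → T ≡ Y)

{-# OPTIONS --safe #-}
module Submission where

-- Since χ_Z = χ_N − χ_{N∖Z}, replacing a set by its complement and negating its coefficient changes
-- a linear combination by a constant vector only.  This turns combinations with constant value on 𝓑
-- into such combinations on 𝓢 and back.  On a min-balanced 𝓑 they are all multiples of the positive
-- one, because otherwise subtracting a suitable multiple would give a conic combination with strictly
-- smaller non-empty support.  So a combination on 𝓢 vanishes if one of its coefficients does, and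
-- otherwise only the coefficient of the new set differs in sign from the rest.  Conversely, the
-- support of a semi-conic combination on a min-semi-balanced 𝓢 is empty or all of 𝓢.

open import Defs
open import Data.Nat.Base using (ℕ; _≤_)
open import Data.Fin.Subset using (Subset; ∁)
open import Data.Product.Base using (_×_)

open import Algebra.Bundles using (CommutativeRing)
import Algebra.Properties.CommutativeSemigroup as CommutativeSemigroupProperties
import Algebra.Properties.Group as GroupProperties
import Algebra.Properties.Ring as RingProperties
open import Data.Bool.Base using (true; false; not)
open import Data.Bool.Properties using (not-involutive)
open import Data.Fin.Base using (Fin)
open import Data.Fin.Subset using (⊥; ⊤; inside; outside)
open import Data.Fin.Subset.Properties using (nonempty?; Empty-unique)
open import Data.List.Base using (List; []; _∷_; foldr; filter; length)
import Data.List.Extrema as Extrema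
open import Data.List.Membership.Propositional using (_∈_)
open import Data.List.Membership.Propositional.Properties
  using (∈-map⁺; ∈-map⁻; ∈-++⁺ˡ; ∈-++⁺ʳ; ∈-filter⁺; ∈-filter⁻)
open import Data.List.Relation.Unary.All as All using (All; []; _∷_)
open import Data.List.Relation.Unary.AllPairs using ([]; _∷_)
open import Data.List.Relation.Unary.Any using (here; there)
open import Data.List.Relation.Unary.Unique.Propositional using (Unique)
import Data.List.Relation.Unary.Unique.Propositional.Properties as Unique
open import Data.Nat.Base using (zero; suc; z≤n; s≤s)
open import Data.Product.Base using (∃; _,_; proj₁; proj₂)
open import Data.Sum.Base using (inj₁; inj₂)
import Data.Vec.Base as Vec
import Data.Vec.Properties as Vec
open import Data.Vec.Relation.Binary.Pointwise.Extensional using (ext; Pointwise-≡⇒≡)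
open import Function.Base using (_∘_)
open import Relation.Binary.Bundles using (TotalOrder)
open import Relation.Binary.Definitions using (tri<; tri≈; tri>)
open import Relation.Binary.PropositionalEquality.Core as ≡
  using (_≡_; _≢_; refl; cong; subst)
import Relation.Binary.Construct.StrictToNonStrict as StrictToNonStrict
import Relation.Binary.Reasoning.Setoid as SetoidReasoning
open import Relation.Binary.Structures using (IsStrictTotalOrder)
open import Relation.Nullary.Decidable.Core
  using (yes; no; False; toWitnessFalse; fromWitnessFalse; T?)
open import Relation.Nullary.Negation.Core using (¬_; contradiction)

private variable n : ℕ

-- Subsets and complements.

subset-ext : {S T : Subset n} → (∀ i → Vec.lookup S i ≡ Vec.lookup T i) → S ≡ T
subset-ext eq = Pointwise-≡⇒≡ (ext eq)

lookup-∁ : (S : Subset n) (i : Fin n) → Vec.lookup (∁ S) i ≡ not (Vec.lookup S i)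
lookup-∁ S i = Vec.lookup-map i not S

∁-involutive : (S : Subset n) → ∁ (∁ S) ≡ S
∁-involutive S = ≡.trans (≡.sym (Vec.map-∘ not not S))
  (≡.trans (Vec.map-cong not-involutive S) (Vec.map-id S))

≢⊥⇒inhabited : {S : Subset n} → S ≢ ⊥ → ∃ λ i → Vec.lookup S i ≡ inside
≢⊥⇒inhabited {S = S} S≢⊥ with nonempty? S
... | yes (i , i∈S) = i , Vec.[]=⇒lookup i∈S
... | no  empty     = contradiction (Empty-unique empty) S≢⊥

∁≢⊥ : {S : Subset n} → S ≢ ⊤ → ∁ S ≢ ⊥
∁≢⊥ {n = n} {S} S≢⊤ eq = S≢⊤
  (≡.trans (≡.sym (∁-involutive S)) (≡.trans (cong ∁ eq) (Vec.map-replicate not outside n)))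

∁≢⊤ : {S : Subset n} → S ≢ ⊥ → ∁ S ≢ ⊤
∁≢⊤ {n = n} {S} S≢⊥ eq = S≢⊥
  (≡.trans (≡.sym (∁-involutive S)) (≡.trans (cong ∁ eq) (Vec.map-replicate not inside n)))

≢⊥⇒≢∁ : {S : Subset n} → S ≢ ⊥ → S ≢ ∁ S
≢⊥⇒≢∁ {S = S} S≢⊥ eq with i , i∈S ← ≢⊥⇒inhabited S≢⊥
  with () ← ≡.trans (≡.sym i∈S) (≡.trans (cong (λ T → Vec.lookup T i) eq)
              (≡.trans (lookup-∁ S i) (cong not i∈S)))

-- Enumeration of the subsets and of the members of a system.

∈-subsets : (S : Subset n) → S ∈ subsets n
∈-subsets Vec.[]           = here refl
∈-subsets (true Vec.∷ S)   = ∈-++⁺ˡ (∈-map⁺ _ (∈-subsets S))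
∈-subsets (false Vec.∷ S)  = ∈-++⁺ʳ _ (∈-map⁺ _ (∈-subsets S))

subsets-unique : ∀ n → Unique (subsets n)
subsets-unique zero    = [] ∷ []
subsets-unique (suc n) = Unique.++⁺
  (Unique.map⁺ Vec.∷-injectiveʳ (subsets-unique n))
  (Unique.map⁺ Vec.∷-injectiveʳ (subsets-unique n))
  λ (p , q) → disjoint (∈-map⁻ _ p) (∈-map⁻ _ q)
  where
  disjoint : ∀ {S} → (∃ λ T → T ∈ subsets n × S ≡ inside Vec.∷ T) →
             ¬ (∃ λ T → T ∈ subsets n × S ≡ outside Vec.∷ T)
  disjoint (_ , _ , refl) (_ , _ , ())

∈-members⁺ : (𝓢 : SetSystem n) {S : Subset n} → S ∈ˢ 𝓢 → S ∈ members 𝓢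
∈-members⁺ 𝓢 = ∈-filter⁺ (member? 𝓢) (∈-subsets _)

∈-members⁻ : (𝓢 : SetSystem n) {S : Subset n} → S ∈ members 𝓢 → S ∈ˢ 𝓢
∈-members⁻ 𝓢 {S} = proj₂ ∘ ∈-filter⁻ (member? 𝓢) {v = S} {xs = subsets _}

-- The listing of the members has no repetitions, so `P` and `Q` account for at most two of its
-- entries. The cardinality hypothesis on a min-balanced system enters the argument through this
-- lemma.
third-member : (𝓢 : SetSystem n) → 3 ≤ ∣ 𝓢 ∣ˢ → (P Q : Subset n) →
               ∃ λ S → S ∈ˢ 𝓢 × S ≢ P × S ≢ Q
third-member {n = n} 𝓢 3≤∣𝓢∣ P Q =
  let S , S∈ , S≢P , S≢Q = third (members 𝓢) 3≤∣𝓢∣ (Unique.filter⁺ (member? 𝓢) (subsets-unique n))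
  in  S , ∈-members⁻ 𝓢 S∈ , S≢P , S≢Q
  where
  second : ∀ xs → 2 ≤ length xs → Unique xs → (R : Subset n) → ∃ λ S → S ∈ xs × S ≢ R
  second (A ∷ [])     (s≤s ()) _ R
  second (A ∷ B ∷ xs) _ ((A≢B ∷ _) ∷ _) R with A ≟ˢ R
  ... | no  A≢R  = A , here refl , A≢R
  ... | yes refl = B , there (here refl) , A≢B ∘ ≡.sym

  third : ∀ xs → 3 ≤ length xs → Unique xs → ∃ λ S → S ∈ xs × S ≢ P × S ≢ Q
  third (A ∷ xs) (s≤s 2≤) (A∉xs ∷ u) with A ≟ˢ P | A ≟ˢ Q
  ... | no A≢P   | no A≢Q = A , here refl , A≢P , A≢Q
  ... | yes refl | _ =
    let S , S∈ , S≢Q = second xs 2≤ u Q in S , there S∈ , All.lookup A∉xs S∈ ∘ ≡.sym , S≢Q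
  ... | no _     | yes refl =
    let S , S∈ , S≢P = second xs 2≤ u P in S , there S∈ , S≢P , All.lookup A∉xs S∈ ∘ ≡.sym

-- Replacing a set by its complement.

exchange : SetSystem n → Subset n → SetSystem n
exchange 𝓠 P = (𝓠 ∖ˢ ｛ P ｝ˢ) ∪ˢ ｛ ∁ P ｝ˢ

exchange-nonTrivial : {𝓠 : SetSystem n} {P : Subset n} →
                      NonTrivial 𝓠 → P ∈ˢ 𝓠 → NonTrivial (exchange 𝓠 P)
exchange-nonTrivial {𝓠 = 𝓠} {P} (_ , ⊥∉ , ⊤∉) P∈ = (∁ P , inj₂ refl) , ⊥∉′ , ⊤∉′
  where
  ⊥∉′ : ⊥ ∉ˢ exchange 𝓠 P
  ⊥∉′ (inj₁ (⊥∈ , _)) = ⊥∉ ⊥∈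
  ⊥∉′ (inj₂ ∁P≡⊥)     = ∁≢⊥ (λ { refl → ⊤∉ P∈ }) ∁P≡⊥
  ⊤∉′ : ⊤ ∉ˢ exchange 𝓠 P
  ⊤∉′ (inj₁ (⊤∈ , _)) = ⊤∉ ⊤∈
  ⊤∉′ (inj₂ ∁P≡⊤)     = ∁≢⊤ (λ { refl → ⊥∉ P∈ }) ∁P≡⊤

module _ {c ℓ₁ ℓ₂} (K : OrderedField c ℓ₁ ℓ₂) where

  open OrderedField K
    using (isStrictTotalOrder; 1≉0; inverse; +-monoˡ-<; *-pos; _<_) renaming (_≤_ to _≼_)

  -- Arithmetic in an ordered field.

  commutativeRing : CommutativeRing c ℓ₁
  commutativeRing = record { isCommutativeRing = OrderedField.isCommutativeRing K }

  open CommutativeRing commutativeRing hiding (refl; zero)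
  open CommutativeRing commutativeRing using () renaming (refl to ≈-refl)
  open RingProperties ring using (-‿distribˡ-*)
  open CommutativeSemigroupProperties +-commutativeSemigroup using (interchange; x∙yz≈y∙xz)
  open GroupProperties +-group using () renaming
    (inverseˡ-unique to +-inverseˡ-unique; ⁻¹-involutive to -‿involutive; ε⁻¹≈ε to -0≈0)
  open IsStrictTotalOrder isStrictTotalOrder
    using (compare; _≟_; irrefl; asym; <-respʳ-≈; <-respˡ-≈)
    renaming (trans to <-trans)
  open SetoidReasoning setoid

  totalOrder : TotalOrder c ℓ₁ _
  totalOrder = record { isTotalOrder = StrictToNonStrict.isTotalOrder _≈_ _<_ isStrictTotalOrder }

  open TotalOrder totalOrder using () renaming (≤-respʳ-≈ to ≼-respʳ-≈)

  pos⇒≉0 : ∀ {x} → 0# < x → ¬ (x ≈ 0#)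
  pos⇒≉0 0<x x≈0 = irrefl (sym x≈0) 0<x

  nonneg⇒≮0 : ∀ {x} → 0# ≼ x → ¬ (x < 0#)
  nonneg⇒≮0 (inj₁ 0<x) x<0 = asym 0<x x<0
  nonneg⇒≮0 (inj₂ 0≈x) x<0 = irrefl (sym 0≈x) x<0

  ≈0⇒nonneg : ∀ {x} → x ≈ 0# → 0# ≼ x
  ≈0⇒nonneg = inj₂ ∘ sym

  nonneg∧≉0⇒pos : ∀ {x} → 0# ≼ x → ¬ (x ≈ 0#) → 0# < x
  nonneg∧≉0⇒pos (inj₁ 0<x) _   = 0<x
  nonneg∧≉0⇒pos (inj₂ 0≈x) x≉0 = contradiction (sym 0≈x) x≉0

  pos⇒-neg : ∀ {x} → 0# < x → - x < 0#
  pos⇒-neg {x} 0<x = <-respʳ-≈ (-‿inverseʳ x) (<-respˡ-≈ (+-identityˡ (- x)) (+-monoˡ-< (- x) 0<x))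

  neg⇒-pos : ∀ {x} → x < 0# → 0# < - x
  neg⇒-pos {x} x<0 = <-respʳ-≈ (+-identityˡ (- x)) (<-respˡ-≈ (-‿inverseʳ x) (+-monoˡ-< (- x) x<0))

  ≼⇒nonneg-difference : ∀ {x y} → x ≼ y → 0# ≼ y - x
  ≼⇒nonneg-difference {x} (inj₁ x<y) = inj₁ (<-respˡ-≈ (-‿inverseʳ x) (+-monoˡ-< (- x) x<y))
  ≼⇒nonneg-difference {x} (inj₂ x≈y) = inj₂ (sym (trans (+-congʳ (sym x≈y)) (-‿inverseʳ x)))

  +-nonneg-pos : ∀ {x y} → 0# ≼ x → 0# < y → 0# < x + y
  +-nonneg-pos {x} {y} (inj₁ 0<x) 0<y =
    <-trans 0<y (<-respˡ-≈ (+-identityˡ y) (+-monoˡ-< y 0<x))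
  +-nonneg-pos {x} {y} (inj₂ 0≈x) 0<y =
    <-respʳ-≈ (trans (sym (+-identityˡ y)) (+-congʳ 0≈x)) 0<y

  +-pos-nonneg : ∀ {x y} → 0# < x → 0# ≼ y → 0# < x + y
  +-pos-nonneg 0<x 0≼y = <-respʳ-≈ (+-comm _ _) (+-nonneg-pos 0≼y 0<x)

  +-nonneg : ∀ {x y} → 0# ≼ x → 0# ≼ y → 0# ≼ x + y
  +-nonneg 0≼x (inj₁ 0<y) = inj₁ (+-nonneg-pos 0≼x 0<y)
  +-nonneg {x} 0≼x (inj₂ 0≈y) = ≼-respʳ-≈ (trans (sym (+-identityʳ x)) (+-congˡ 0≈y)) 0≼x

  *-nonneg : ∀ {x y} → 0# ≼ x → 0# ≼ y → 0# ≼ x * y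
  *-nonneg (inj₁ 0<x) (inj₁ 0<y) = inj₁ (*-pos 0<x 0<y)
  *-nonneg {x} {y} (inj₂ 0≈x) _  = inj₂ (trans (sym (zeroˡ y)) (*-congʳ 0≈x))
  *-nonneg {x} {y} _ (inj₂ 0≈y)  = inj₂ (trans (sym (zeroʳ x)) (*-congˡ 0≈y))

  *-neg-pos : ∀ {x y} → x < 0# → 0# < y → x * y < 0#
  *-neg-pos {x} {y} x<0 0<y = <-respˡ-≈
    (trans (-‿cong (sym (-‿distribˡ-* x y))) (-‿involutive (x * y)))
    (pos⇒-neg (*-pos (neg⇒-pos x<0) 0<y))

  0<1 : 0# < 1#
  0<1 with compare 0# 1#
  ... | tri< 0<1 _ _ = 0<1
  ... | tri≈ _ 0≈1 _ = contradiction (sym 0≈1) 1≉0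
  ... | tri> _ _ 1<0 = contradiction 1<0 (asym
    (<-respʳ-≈ (trans (sym (-‿distribˡ-* 1# (- 1#))) (trans (-‿cong (*-identityˡ _)) (-‿involutive 1#)))
      (*-pos (neg⇒-pos 1<0) (neg⇒-pos 1<0))))

  infix 8 _⁻¹
  -- Made total by the value 0 at 0, so that quotients of coefficients can be formed at every
  -- subset.
  _⁻¹ : Carrier → Carrier
  x ⁻¹ with x ≟ 0#
  ... | yes _   = 0#
  ... | no  x≉0 = proj₁ (inverse x x≉0)

  ⁻¹-inverseʳ : ∀ {x} → ¬ (x ≈ 0#) → x * x ⁻¹ ≈ 1#
  ⁻¹-inverseʳ {x} x≉0 with x ≟ 0#
  ... | yes x≈0 = contradiction x≈0 x≉0
  ... | no  x≉0 = proj₂ (inverse x x≉0)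

  ⁻¹-pos : ∀ {x} → 0# < x → 0# < x ⁻¹
  ⁻¹-pos {x} 0<x with compare (x ⁻¹) 0# | ⁻¹-inverseʳ (pos⇒≉0 0<x)
  ... | tri> _ _ 0<x⁻¹ | _      = 0<x⁻¹
  ... | tri≈ _ x⁻¹≈0 _ | xx⁻¹≈1 =
    contradiction (trans (sym xx⁻¹≈1) (trans (*-congˡ x⁻¹≈0) (zeroʳ x))) 1≉0
  ... | tri< x⁻¹<0 _ _ | xx⁻¹≈1 = contradiction
    (<-respˡ-≈ (trans (*-comm _ _) xx⁻¹≈1) (*-neg-pos x⁻¹<0 0<x)) (asym 0<1)

  -- As `u` is positive, a negative `x` forces `a` to be negative, and then `y` is negative too.
  -- This compares the signs of two coefficients of a multiple of a positive combination.
  neg-multiple : ∀ {a x y u v} → 0# < u → 0# < v → x ≈ a * u → y ≈ a * v → x < 0# → y < 0#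
  neg-multiple {a} 0<u 0<v x≈au y≈av x<0 with compare a 0#
  ... | tri< a<0 _ _ = <-respˡ-≈ (sym y≈av) (*-neg-pos a<0 0<v)
  ... | tri≈ _ a≈0 _ = contradiction x<0 (nonneg⇒≮0
    (≼-respʳ-≈ (sym x≈au) (*-nonneg (≈0⇒nonneg a≈0) (inj₁ 0<u))))
  ... | tri> _ _ 0<a = contradiction x<0 (nonneg⇒≮0
    (≼-respʳ-≈ (sym x≈au) (*-nonneg (inj₁ 0<a) (inj₁ 0<u))))

  -- Incidence vectors and their linear combinations.

  χ-inside : {S : Subset n} {i : Fin n} → Vec.lookup S i ≡ inside → χ K S i ≈ 1#
  χ-inside {S = S} {i} _ with true ← Vec.lookup S i = ≈-refl

  χ-nonneg : (S : Subset n) (i : Fin n) → 0# ≼ χ K S i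
  χ-nonneg S i with Vec.lookup S i
  ... | true  = inj₁ 0<1
  ... | false = inj₂ ≈-refl

  χ-⊤ : (i : Fin n) → χ K ⊤ i ≈ 1#
  χ-⊤ i = χ-inside {S = ⊤} {i} (Vec.lookup-replicate i inside)

  χ-∁ : (S : Subset n) (i : Fin n) → χ K S i + χ K (∁ S) i ≈ 1#
  χ-∁ S i rewrite lookup-∁ S i with Vec.lookup S i
  ... | true  = +-identityʳ 1#
  ... | false = +-identityˡ 1#

  comb : List (Subset n) → (Subset n → Carrier) → Fin n → Carrier
  comb xs f i = foldr (λ S acc → f S * χ K S i + acc) 0# xs

  -- Summing over all subsets lets combinations on different systems be added and compared. The
  -- system is then recorded by requiring zero coefficients outside it.
  total : (Subset n → Carrier) → Fin n → Carrier
  total {n} = comb (subsets n)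

  comb-+* : (xs : List (Subset n)) (f g : Subset n → Carrier) (a : Carrier) (i : Fin n) →
            comb xs (λ S → f S + a * g S) i ≈ comb xs f i + a * comb xs g i
  comb-+* []       f g a i = sym (trans (+-identityˡ _) (zeroʳ a))
  comb-+* (S ∷ xs) f g a i = begin
    (f S + a * g S) * x + comb xs (λ S → f S + a * g S) i  ≈⟨ +-congˡ (comb-+* xs f g a i) ⟩
    (f S + a * g S) * x + (F + a * G)    ≈⟨ +-congʳ (distribʳ x (f S) (a * g S)) ⟩
    (f S * x + a * g S * x) + (F + a * G)  ≈⟨ interchange _ _ _ _ ⟩
    (f S * x + F) + (a * g S * x + a * G)
      ≈⟨ +-congˡ (trans (+-congʳ (*-assoc a _ _)) (sym (distribˡ a _ _))) ⟩
    (f S * x + F) + a * (g S * x + G)    ∎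
    where
    x = χ K S i
    F = comb xs f i
    G = comb xs g i

  comb-* : (xs : List (Subset n)) (a : Carrier) (f : Subset n → Carrier) (i : Fin n) →
           comb xs (λ S → a * f S) i ≈ a * comb xs f i
  comb-* []       a f i = sym (zeroʳ a)
  comb-* (S ∷ xs) a f i =
    trans (+-cong (*-assoc a _ _) (comb-* xs a f i)) (sym (distribˡ a _ _))

  comb-nonneg : (xs : List (Subset n)) {f : Subset n → Carrier} (i : Fin n) →
                (∀ S → 0# ≼ f S) → 0# ≼ comb xs f i
  comb-nonneg []       i f≥0 = inj₂ ≈-refl
  comb-nonneg (S ∷ xs) i f≥0 = +-nonneg (*-nonneg (f≥0 S) (χ-nonneg S i)) (comb-nonneg xs i f≥0)

  comb-pos : ∀ {xs : List (Subset n)} {f : Subset n → Carrier} {S i} → (∀ S → 0# ≼ f S) →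
             S ∈ xs → 0# < f S → Vec.lookup S i ≡ inside → 0# < comb xs f i
  comb-pos {xs = S ∷ xs} {i = i} f≥0 (here refl) 0<fS i∈S = +-pos-nonneg
    (<-respʳ-≈ (sym (trans (*-congˡ (χ-inside {S = S} {i} i∈S)) (*-identityʳ _))) 0<fS)
    (comb-nonneg xs i f≥0)
  comb-pos {xs = T ∷ xs} {i = i} f≥0 (there S∈) 0<fS i∈S = +-nonneg-pos
    (*-nonneg (f≥0 T) (χ-nonneg T i)) (comb-pos f≥0 S∈ 0<fS i∈S)

  linComb≈total : (𝓢 : SetSystem n) (f g : Subset n → Carrier) →
                  (∀ S → S ∈ˢ 𝓢 → f S ≈ g S) → (∀ S → S ∉ˢ 𝓢 → g S ≈ 0#) →
                  ∀ i → linComb K 𝓢 f i ≈ total g i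
  linComb≈total {n} 𝓢 f g f≈g g≈0 i = go (subsets n)
    where
    go : ∀ xs → comb (filter (member? 𝓢) xs) f i ≈ comb xs g i
    go []       = ≈-refl
    go (S ∷ xs) with member? 𝓢 S
    ... | yes S∈ = +-cong (*-congʳ (f≈g S S∈)) (go xs)
    ... | no  S∉ = trans (go xs)
      (sym (trans (+-congʳ (trans (*-congʳ (g≈0 S S∉)) (zeroˡ _))) (+-identityˡ _)))

  restrict : SetSystem n → (Subset n → Carrier) → Subset n → Carrier
  restrict 𝓢 f S with member? 𝓢 S
  ... | yes _ = f S
  ... | no  _ = 0#

  restrict-∈ : (𝓢 : SetSystem n) (f : Subset n → Carrier) {S : Subset n} → S ∈ˢ 𝓢 → restrict 𝓢 f S ≡ f S
  restrict-∈ 𝓢 f {S} S∈ with member? 𝓢 S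
  ... | yes _ = refl
  ... | no S∉ = contradiction S∈ S∉

  restrict-∉ : (𝓢 : SetSystem n) (f : Subset n → Carrier) {S : Subset n} → S ∉ˢ 𝓢 → restrict 𝓢 f S ≈ 0#
  restrict-∉ 𝓢 f {S} S∉ with member? 𝓢 S
  ... | yes S∈ = contradiction S∈ S∉
  ... | no _   = ≈-refl

  linComb≈total-restrict : (𝓢 : SetSystem n) (f : Subset n → Carrier) →
                           ∀ i → linComb K 𝓢 f i ≈ total (restrict 𝓢 f) i
  linComb≈total-restrict 𝓢 f = linComb≈total 𝓢 f (restrict 𝓢 f)
    (λ S S∈ → reflexive (≡.sym (restrict-∈ 𝓢 f S∈))) (λ S → restrict-∉ 𝓢 f)

  δ : Subset n → Subset n → Carrier
  δ P S with P ≟ˢ S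
  ... | yes _ = 1#
  ... | no  _ = 0#

  δ-≡ : (P : Subset n) → δ P P ≈ 1#
  δ-≡ P with P ≟ˢ P
  ... | yes _  = ≈-refl
  ... | no P≢P = contradiction refl P≢P

  δ-≢ : {P S : Subset n} → P ≢ S → δ P S ≈ 0#
  δ-≢ {P = P} {S} P≢S with P ≟ˢ S
  ... | yes P≡S = contradiction P≡S P≢S
  ... | no _    = ≈-refl

  δ-nonneg : (P S : Subset n) → 0# ≼ δ P S
  δ-nonneg P S with P ≟ˢ S
  ... | yes _ = inj₁ 0<1
  ... | no  _ = inj₂ ≈-refl

  total-δ : (P : Subset n) (i : Fin n) → total (δ P) i ≈ χ K P i
  total-δ {n} P i = once (subsets n) (subsets-unique n) (∈-subsets P)
    where
    never : ∀ xs → All (P ≢_) xs → comb xs (δ P) i ≈ 0#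
    never []       []           = ≈-refl
    never (S ∷ xs) (P≢S ∷ P∉xs) =
      trans (+-cong (trans (*-congʳ (δ-≢ P≢S)) (zeroˡ _)) (never xs P∉xs)) (+-identityˡ 0#)
    once : ∀ xs → Unique xs → P ∈ xs → comb xs (δ P) i ≈ χ K P i
    once (_ ∷ xs) (P∉xs ∷ _) (here refl) =
      trans (+-cong (trans (*-congʳ (δ-≡ P)) (*-identityˡ _)) (never xs P∉xs)) (+-identityʳ _)
    once (S ∷ xs) (S∉xs ∷ u) (there P∈) =
      trans (+-cong (trans (*-congʳ (δ-≢ (All.lookup S∉xs P∈ ∘ ≡.sym))) (zeroˡ _)) (once xs u P∈))
        (+-identityˡ _)

  -- Complementary pairs, and supports of combinations.

  Constant : (Subset n → Carrier) → Set _
  Constant f = IsConstant K (total f)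

  Supported : SetSystem n → (Subset n → Carrier) → Set _
  Supported 𝓢 f = ∀ S → S ∉ˢ 𝓢 → f S ≈ 0#

  -- The coefficients of χ_P + χ_{N∖P} = χ_N.
  pair : Subset n → Subset n → Carrier
  pair P S = δ P S + 1# * δ (∁ P) S

  pair-nonneg : (P S : Subset n) → 0# ≼ pair P S
  pair-nonneg P S = +-nonneg (δ-nonneg P S) (*-nonneg (inj₁ 0<1) (δ-nonneg (∁ P) S))

  pair-P : {P : Subset n} → P ≢ ⊥ → pair P P ≈ 1#
  pair-P {P = P} P≢⊥ = trans
    (+-cong (δ-≡ P) (trans (*-congˡ (δ-≢ (≢⊥⇒≢∁ P≢⊥ ∘ ≡.sym))) (zeroʳ 1#))) (+-identityʳ 1#)

  pair-∁P : {P : Subset n} → P ≢ ⊥ → pair P (∁ P) ≈ 1#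
  pair-∁P {P = P} P≢⊥ = trans
    (+-cong (δ-≢ (≢⊥⇒≢∁ P≢⊥)) (trans (*-identityˡ _) (δ-≡ (∁ P)))) (+-identityˡ 1#)

  pair-≢ : {P S : Subset n} → S ≢ P → S ≢ ∁ P → pair P S ≈ 0#
  pair-≢ S≢P S≢∁P = trans
    (+-cong (δ-≢ (S≢P ∘ ≡.sym)) (trans (*-congˡ (δ-≢ (S≢∁P ∘ ≡.sym))) (zeroʳ 1#))) (+-identityˡ 0#)

  -- The factor `1#` in `pair` is there so that `comb-+*` splits the sum.
  total-pair : (P : Subset n) (i : Fin n) → total (pair P) i ≈ 1#
  total-pair {n} P i = begin
    total (pair P) i                        ≈⟨ comb-+* (subsets n) (δ P) (δ (∁ P)) 1# i ⟩
    total (δ P) i + 1# * total (δ (∁ P)) i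
      ≈⟨ +-cong (total-δ P i) (trans (*-identityˡ _) (total-δ (∁ P) i)) ⟩
    χ K P i + χ K (∁ P) i                   ≈⟨ χ-∁ P i ⟩
    1#                                      ∎

  constant-+* : {f g : Subset n → Carrier} (a : Carrier) →
                Constant f → Constant g → Constant (λ S → f S + a * g S)
  constant-+* {n} {f} {g} a (r , f≈r) (s , g≈s) = r + a * s , λ i →
    trans (comb-+* (subsets n) f g a i) (+-cong (f≈r i) (*-congˡ (g≈s i)))

  -- Meant for X ∈ {P, N∖P}: the coefficient of X moves, with opposite sign, to N∖X.
  clear : Subset n → Subset n → (Subset n → Carrier) → Subset n → Carrier
  clear P X f S = f S + - f X * pair P S

  module _ (P X : Subset n) (f : Subset n → Carrier) where

    clear-constant : Constant f → Constant (clear P X f)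
    clear-constant f-const = constant-+* (- f X) f-const (1# , total-pair P)

    clear-pair : {S : Subset n} → pair P S ≈ 1# → clear P X f S ≈ f S - f X
    clear-pair pair≈1 = +-congˡ (trans (*-congˡ pair≈1) (*-identityʳ _))

    clear-≢ : {S : Subset n} → S ≢ P → S ≢ ∁ P → clear P X f S ≈ f S
    clear-≢ S≢P S≢∁P =
      trans (+-congˡ (trans (*-congˡ (pair-≢ S≢P S≢∁P)) (zeroʳ _))) (+-identityʳ _)

    clear-X : pair P X ≈ 1# → clear P X f X ≈ 0#
    clear-X pair≈1 = trans (clear-pair pair≈1) (-‿inverseʳ _)

    clear-off : {S : Subset n} → pair P S ≈ 1# → f S ≈ 0# → clear P X f S ≈ - f X
    clear-off pair≈1 fS≈0 = trans (clear-pair pair≈1) (trans (+-congʳ fS≈0) (+-identityˡ _))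

  -- Membership is the outcome of the zero test and not the negated equation itself, because
  -- `Member` must live in the lowest universe while `_≈_` may live in any.
  support : (Subset n → Carrier) → SetSystem n
  support f .Member  S = False (f S ≟ 0#)
  support f .member? S = T? _

  module _ (f : Subset n → Carrier) where

    ∈-support⁺ : ∀ {S} → ¬ (f S ≈ 0#) → S ∈ˢ support f
    ∈-support⁺ = fromWitnessFalse

    ∈-support⁻ : ∀ {S} → S ∈ˢ support f → ¬ (f S ≈ 0#)
    ∈-support⁻ = toWitnessFalse

    support-supported : Supported (support f) f
    support-supported S S∉ with f S ≟ 0#
    ... | yes fS≈0 = fS≈0
    ... | no _     = contradiction _ S∉

    module _ (𝓢 : SetSystem n) (f-supp : Supported 𝓢 f) where

      support-⊆ : ∀ {S} → S ∈ˢ support f → S ∈ˢ 𝓢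
      support-⊆ {S} S∈ with member? 𝓢 S
      ... | yes S∈𝓢 = S∈𝓢
      ... | no  S∉𝓢 = contradiction (f-supp S S∉𝓢) (∈-support⁻ S∈)

      support-⊂ : ∀ {T} → T ∈ˢ 𝓢 → f T ≈ 0# → support f ⊂ˢ 𝓢
      support-⊂ T∈ fT≈0 = support-⊆ , λ 𝓢⊆ → ∈-support⁻ (𝓢⊆ T∈) fT≈0

      support-nonTrivial : ∀ {S} → NonTrivial 𝓢 → ¬ (f S ≈ 0#) → NonTrivial (support f)
      support-nonTrivial {S} (_ , ⊥∉ , ⊤∉) fS≉0 =
        (S , ∈-support⁺ fS≉0) , ⊥∉ ∘ support-⊆ , ⊤∉ ∘ support-⊆

  -- Balancedness and minimality in terms of supported coefficient functions.

  Positive : SetSystem n → (Subset n → Carrier) → Set _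
  Positive 𝓢 f = ∀ S → S ∈ˢ 𝓢 → 0# < f S

  supported-nonneg : (𝓢 : SetSystem n) {f : Subset n → Carrier} → Supported 𝓢 f →
                     (∀ S → S ∈ˢ 𝓢 → 0# ≼ f S) → ∀ S → 0# ≼ f S
  supported-nonneg 𝓢 f-supp f≥0 S with member? 𝓢 S
  ... | yes S∈ = f≥0 S S∈
  ... | no  S∉ = ≈0⇒nonneg (f-supp S S∉)

  -- The constant value `r` is positive, since some member is non-empty and has a positive
  -- coefficient. Dividing by `r` turns the value into 1.
  balanced⁺ : {𝓢 : SetSystem n} {f : Subset n → Carrier} → NonTrivial 𝓢 →
              Positive 𝓢 f → Supported 𝓢 f → Constant f → Balanced K 𝓢
  balanced⁺ {n} {𝓢} {f} nt@((S , S∈) , ⊥∉ , _) f>0 f-supp (r , f≈r) =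
    nt , (λ T → r ⁻¹ * f T) ,
    (λ T → inj₁ ∘ scaled>0 T) , (λ T → pos⇒≉0 ∘ scaled>0 T) , λ i → begin
      linComb K 𝓢 (λ T → r ⁻¹ * f T) i
        ≈⟨ linComb≈total 𝓢 _ _ (λ _ _ → ≈-refl) (λ T T∉ → trans (*-congˡ (f-supp T T∉)) (zeroʳ _)) i ⟩
      total (λ T → r ⁻¹ * f T) i  ≈⟨ comb-* (subsets n) (r ⁻¹) f i ⟩
      r ⁻¹ * total f i            ≈⟨ *-congˡ (f≈r i) ⟩
      r ⁻¹ * r                    ≈⟨ trans (*-comm _ _) (⁻¹-inverseʳ (pos⇒≉0 0<r)) ⟩
      1#                          ≈⟨ χ-⊤ i ⟨
      χ K ⊤ i                     ∎
    where
    0<r : 0# < r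
    0<r = let i , i∈S = ≢⊥⇒inhabited {S = S} (λ { refl → ⊥∉ S∈ }) in
      <-respʳ-≈ (f≈r i)
        (comb-pos {S = S} {i} (supported-nonneg 𝓢 f-supp (λ T → inj₁ ∘ f>0 T)) (∈-subsets S) (f>0 S S∈) i∈S)
    scaled>0 : ∀ T → T ∈ˢ 𝓢 → 0# < r ⁻¹ * f T
    scaled>0 T T∈ = *-pos (⁻¹-pos 0<r) (f>0 T T∈)

  balanced⁻ : {𝓢 : SetSystem n} → Balanced K 𝓢 →
              ∃ λ f → Positive 𝓢 f × Supported 𝓢 f × (∀ i → total f i ≈ 1#)
  balanced⁻ {𝓢 = 𝓢} (_ , f , f≥0 , f≉0 , f≈χ) = restrict 𝓢 f ,
    (λ S S∈ → subst (0# <_) (≡.sym (restrict-∈ 𝓢 f S∈)) (nonneg∧≉0⇒pos (f≥0 S S∈) (f≉0 S S∈))) ,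
    (λ S → restrict-∉ 𝓢 f) ,
    λ i → trans (sym (linComb≈total-restrict 𝓢 f i)) (trans (f≈χ i) (χ-⊤ i))

  semiBalanced⁺ : {𝓢 : SetSystem n} {f : Subset n → Carrier} → NonTrivial 𝓢 →
                  SemiConic K 𝓢 f → AllNonZero K 𝓢 f → Supported 𝓢 f → Constant f → SemiBalanced K 𝓢
  semiBalanced⁺ {𝓢 = 𝓢} {f} nt semi f≉0 f-supp (r , f≈r) = nt , f , semi , f≉0 , r ,
    λ i → trans (linComb≈total 𝓢 f f (λ _ _ → ≈-refl) f-supp i) (f≈r i)

  semiBalanced⁻ : {𝓢 : SetSystem n} → SemiBalanced K 𝓢 →
                  ∃ λ f → AllNonZero K 𝓢 f × Supported 𝓢 f × Constant f
  semiBalanced⁻ {𝓢 = 𝓢} (_ , f , _ , f≉0 , r , f≈r) = restrict 𝓢 f ,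
    (λ S S∈ → subst (λ x → ¬ (x ≈ 0#)) (≡.sym (restrict-∈ 𝓢 f S∈)) (f≉0 S S∈)) ,
    (λ S → restrict-∉ 𝓢 f) ,
    r , λ i → trans (sym (linComb≈total-restrict 𝓢 f i)) (f≈r i)

  exceptional⁺ : {𝓢 : SetSystem n} {T : Subset n} {f : Subset n → Carrier} → T ∈ˢ 𝓢 →
                 Supported 𝓢 f → Constant f → f T < 0# →
                 (∀ S → S ∈ˢ 𝓢 → S ≢ T → 0# ≼ f S) → Exceptional K 𝓢 T
  exceptional⁺ {𝓢 = 𝓢} {f = f} T∈ f-supp (r , f≈r) fT<0 f≥0 = T∈ , f ,
    (r , λ i → trans (linComb≈total 𝓢 f f (λ _ _ → ≈-refl) f-supp i) (f≈r i)) , fT<0 , f≥0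

  exceptional⁻ : {𝓢 : SetSystem n} {T : Subset n} → Exceptional K 𝓢 T →
                 ∃ λ f → Supported 𝓢 f × Constant f × f T < 0# × (∀ S → S ≢ T → 0# ≼ f S)
  exceptional⁻ {𝓢 = 𝓢} {T} (T∈ , f , (r , f≈r) , fT<0 , f≥0) = restrict 𝓢 f ,
    (λ S → restrict-∉ 𝓢 f) ,
    (r , λ i → trans (sym (linComb≈total-restrict 𝓢 f i)) (f≈r i)) ,
    subst (_< 0#) (≡.sym (restrict-∈ 𝓢 f T∈)) fT<0 ,
    restrict≥0
    where
    restrict≥0 : ∀ S → S ≢ T → 0# ≼ restrict 𝓢 f S
    restrict≥0 S S≢T with member? 𝓢 S
    ... | yes S∈ = f≥0 S S∈ S≢T
    ... | no _   = inj₂ ≈-refl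

  -- A combination that misses a member of the system has a support to which minimality applies.
  minBalanced-vanish : {𝓑 : SetSystem n} → MinBalanced K 𝓑 →
    {f : Subset n → Carrier} → (∀ S → 0# ≼ f S) → Supported 𝓑 f → Constant f →
    ∀ {T} → T ∈ˢ 𝓑 → f T ≈ 0# → ∀ S → f S ≈ 0#
  minBalanced-vanish {𝓑 = 𝓑} ((nt , _) , minimal) {f} f≥0 f-supp f-const T∈ fT≈0 S with f S ≟ 0#
  ... | yes fS≈0 = fS≈0
  ... | no  fS≉0 = contradiction
    (balanced⁺ (support-nonTrivial f 𝓑 f-supp nt fS≉0) (λ U U∈ → nonneg∧≉0⇒pos (f≥0 U) (∈-support⁻ f U∈))
      (support-supported f) f-const)
    (minimal (support f) (support-⊂ f 𝓑 f-supp T∈ fT≈0))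

  -- Passing to the support keeps at most one negative coefficient, so a non-zero `f` with a zero at
  -- `T` would make a strict subsystem semi-balanced.
  minSemiBalanced-vanish : {𝓢 : SetSystem n} → MinSemiBalanced K 𝓢 →
    {f : Subset n → Carrier} → (∀ S T → f S < 0# → f T < 0# → S ≡ T) → Supported 𝓢 f → Constant f →
    ∀ {T} → T ∈ˢ 𝓢 → f T ≈ 0# → ∀ S → f S ≈ 0#
  minSemiBalanced-vanish {𝓢 = 𝓢} ((nt , _) , minimal) {f} semi f-supp f-const T∈ fT≈0 S with f S ≟ 0#
  ... | yes fS≈0 = fS≈0
  ... | no  fS≉0 = contradiction
    (semiBalanced⁺ (support-nonTrivial f 𝓢 f-supp nt fS≉0) (λ U V _ _ → semi U V) (λ U → ∈-support⁻ f)
      (support-supported f) f-const)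
    (minimal (support f) (support-⊂ f 𝓢 f-supp T∈ fT≈0))

  -- Subtract from f the largest multiple of μ that keeps it non-negative: a coefficient vanishes,
  -- so all of them do.
  minBalanced-multiple : {𝓑 : SetSystem n} → MinBalanced K 𝓑 →
    {μ : Subset n → Carrier} → Positive 𝓑 μ → Supported 𝓑 μ → Constant μ →
    {f : Subset n → Carrier} → Supported 𝓑 f → Constant f →
    ∃ λ a → ∀ S → f S ≈ a * μ S
  minBalanced-multiple {n} {𝓑} min@((((S₀ , S₀∈) , _) , _) , _) {μ} μ>0 μ-supp μ-const {f} f-supp f-const =
    ρ T , λ S → trans (+-inverseˡ-unique (f S) (- ρ T * μ S) (g≈0 S))
                      (trans (-‿cong (sym (-‿distribˡ-* _ _))) (-‿involutive _))
    where
    open Extrema totalOrder using (argmin; argmin-all; f[argmin]≤f[xs])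
    ρ : Subset n → Carrier
    ρ S = f S * μ S ⁻¹
    T : Subset n
    T = argmin ρ S₀ (members 𝓑)
    T∈ : T ∈ˢ 𝓑
    T∈ = argmin-all ρ {P = Member 𝓑} S₀∈ (All.tabulate (∈-members⁻ 𝓑))
    ρT≼ : ∀ S → S ∈ˢ 𝓑 → ρ T ≼ ρ S
    ρT≼ S S∈ = All.lookup (f[argmin]≤f[xs] {f = ρ} S₀ (members 𝓑)) (∈-members⁺ 𝓑 S∈)
    g : Subset n → Carrier
    g S = f S + - ρ T * μ S
    g-supp : Supported 𝓑 g
    g-supp S S∉ = trans (+-cong (f-supp S S∉) (trans (*-congˡ (μ-supp S S∉)) (zeroʳ _))) (+-identityˡ 0#)
    g≈ : ∀ S → S ∈ˢ 𝓑 → g S ≈ (ρ S - ρ T) * μ S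
    g≈ S S∈ = begin
      f S + - ρ T * μ S      ≈⟨ +-congʳ (trans (sym (*-identityʳ _)) (*-congˡ (sym μ⁻¹μ≈1))) ⟩
      f S * (μ S ⁻¹ * μ S) + - ρ T * μ S  ≈⟨ +-congʳ (*-assoc _ _ _) ⟨
      ρ S * μ S + - ρ T * μ S  ≈⟨ distribʳ _ _ _ ⟨
      (ρ S - ρ T) * μ S      ∎
      where
      μ⁻¹μ≈1 : μ S ⁻¹ * μ S ≈ 1#
      μ⁻¹μ≈1 = trans (*-comm _ _) (⁻¹-inverseʳ (pos⇒≉0 (μ>0 S S∈)))
    g≥0 : ∀ S → S ∈ˢ 𝓑 → 0# ≼ g S
    g≥0 S S∈ = ≼-respʳ-≈ (sym (g≈ S S∈))
      (*-nonneg (≼⇒nonneg-difference (ρT≼ S S∈)) (inj₁ (μ>0 S S∈)))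
    g≈0 : ∀ S → g S ≈ 0#
    g≈0 = minBalanced-vanish min (supported-nonneg 𝓑 g-supp g≥0) g-supp (constant-+* (- ρ T) f-const μ-const)
      T∈ (trans (g≈ T T∈) (trans (*-congʳ (-‿inverseʳ _)) (zeroˡ _)))

  -- Transport of combinations between a system and its exchange.

  module Exchange {𝓠 : SetSystem n} {P : Subset n} (nt : NonTrivial 𝓠) (P∈ : P ∈ˢ 𝓠) where

    P≢⊥ : P ≢ ⊥
    P≢⊥ refl = proj₁ (proj₂ nt) P∈

    P≢∁P : P ≢ ∁ P
    P≢∁P = ≢⊥⇒≢∁ P≢⊥

    P∉exchange : P ∉ˢ exchange 𝓠 P
    P∉exchange (inj₁ (_ , P≢P)) = P≢P refl
    P∉exchange (inj₂ ∁P≡P)      = P≢∁P (≡.sym ∁P≡P)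

    nonTrivial : NonTrivial (exchange 𝓠 P)
    nonTrivial = exchange-nonTrivial {𝓠 = 𝓠} nt P∈

    ∈-other : ∀ {S} → S ∈ˢ exchange 𝓠 P → S ≢ ∁ P → S ∈ˢ 𝓠 × S ≢ P
    ∈-other (inj₁ (S∈ , P≢S)) _    = S∈ , P≢S ∘ ≡.sym
    ∈-other (inj₂ ∁P≡S)       S≢∁P = contradiction (≡.sym ∁P≡S) S≢∁P

    forward : (Subset n → Carrier) → Subset n → Carrier
    forward = clear P P

    back : (Subset n → Carrier) → Subset n → Carrier
    back = clear P (∁ P)

    forward-supported : ∀ {f} → Supported 𝓠 f → Supported (exchange 𝓠 P) (forward f)
    forward-supported {f} f-supp S S∉ with S ≟ˢ P
    ... | yes refl = clear-X P P f (pair-P P≢⊥)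
    ... | no S≢P   = trans (clear-≢ P P f S≢P (λ { refl → S∉ (inj₂ refl) }))
                       (f-supp S (λ S∈ → S∉ (inj₁ (S∈ , S≢P ∘ ≡.sym))))

    back-supported : ∀ {f} → Supported (exchange 𝓠 P) f → Supported 𝓠 (back f)
    back-supported {f} f-supp S S∉ with S ≟ˢ ∁ P
    ... | yes refl = clear-X P (∁ P) f (pair-∁P P≢⊥)
    ... | no S≢∁P  = trans (clear-≢ P (∁ P) f (λ { refl → S∉ P∈ }) S≢∁P)
                       (f-supp S (λ S∈ → S∉ (proj₁ (∈-other S∈ S≢∁P))))

    module _ {f : Subset n → Carrier} (f-supp : Supported (exchange 𝓠 P) f) where

      back-P : back f P ≈ - f (∁ P)
      back-P = clear-off P (∁ P) f (pair-P P≢⊥) (f-supp P P∉exchange)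

      -- No information is lost by `back`: the coefficient of `∁ P` reappears at `P` with opposite
      -- sign, and the others stay in place.
      back-≈0 : (∀ S → back f S ≈ 0#) → ∀ S → f S ≈ 0#
      back-≈0 back≈0 S with S ≟ˢ P | S ≟ˢ ∁ P
      ... | yes refl | _        = f-supp P P∉exchange
      ... | no _     | yes refl = trans (sym (-‿involutive _))
                                    (trans (-‿cong (trans (sym back-P) (back≈0 P))) -0≈0)
      ... | no S≢P   | no S≢∁P  = trans (sym (clear-≢ P (∁ P) f S≢P S≢∁P)) (back≈0 S)

      -- A zero stays in place unless it sits at `∁ P`, in which case it moves to `P`. Either way
      -- `back f` misses a member of `𝓠`, as the minimality arguments require.
      back-zero : ∀ {S} → S ∈ˢ exchange 𝓠 P → f S ≈ 0# → ∃ λ T → T ∈ˢ 𝓠 × back f T ≈ 0#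
      back-zero {S} S∈ fS≈0 with S ≟ˢ ∁ P
      ... | yes refl = P , P∈ , trans back-P (trans (-‿cong fS≈0) -0≈0)
      ... | no S≢∁P  = let S∈𝓠 , S≢P = ∈-other S∈ S≢∁P in
                       S , S∈𝓠 , trans (clear-≢ P (∁ P) f S≢P S≢∁P) fS≈0

    -- The exchanged system inherits minimality: a combination on a strict subsystem is carried back
    -- to a combination on 𝓠 that misses a member.
    ⊂-exchange-vanish : {𝓣 : SetSystem n} {f : Subset n → Carrier} → 𝓣 ⊂ˢ exchange 𝓠 P →
      (∀ {T} → T ∈ˢ 𝓠 → back f T ≈ 0# → ∀ S → back f S ≈ 0#) →
      AllNonZero K 𝓣 f → Supported 𝓣 f → ¬ (∃ λ S → S ∈ˢ 𝓣)
    ⊂-exchange-vanish {𝓣} {f} (𝓣⊆ , 𝓢⊈𝓣) vanish f≉0 f-supp𝓣 (S , S∈) = 𝓢⊈𝓣 𝓢⊆𝓣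
      where
      f-supp : Supported (exchange 𝓠 P) f
      f-supp T T∉ = f-supp𝓣 T (T∉ ∘ 𝓣⊆)
      𝓢⊆𝓣 : ∀ {T} → T ∈ˢ exchange 𝓠 P → T ∈ˢ 𝓣
      𝓢⊆𝓣 {T} T∈ with member? 𝓣 T
      ... | yes T∈𝓣 = T∈𝓣
      ... | no  T∉𝓣 = let U , U∈ , back≈0 = back-zero f-supp T∈ (f-supp𝓣 T T∉𝓣) in
                      contradiction (back-≈0 f-supp (vanish U∈ back≈0) S) (f≉0 S S∈)

  -- From min-balanced to purely min-semi-balanced systems.

  module FromMinBalanced {𝓑 : SetSystem n} {Z : Subset n}
    (min : MinBalanced K 𝓑) (3≤∣𝓑∣ : 3 ≤ ∣ 𝓑 ∣ˢ) (Z∈ : Z ∈ˢ 𝓑) where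

    open Exchange {𝓠 = 𝓑} (proj₁ (proj₁ min)) Z∈

    𝓢 : SetSystem n
    𝓢 = exchange 𝓑 Z

    private
      balanced = balanced⁻ (proj₁ min)
      μ        = proj₁ balanced
      μ>0      = proj₁ (proj₂ balanced)
      μ-supp   = proj₁ (proj₂ (proj₂ balanced))
      μ-const : Constant μ
      μ-const  = 1# , proj₂ (proj₂ (proj₂ balanced))

    -- Otherwise the coefficients of `pair Z` form a conic combination on `𝓑` that is zero at a
    -- third member. By minimality it vanishes everywhere, yet its coefficient at `Z` is 1.
    ∁Z∉ : ∁ Z ∉ˢ 𝓑
    ∁Z∉ ∁Z∈ = let S , S∈ , S≢Z , S≢∁Z = third-member 𝓑 3≤∣𝓑∣ Z (∁ Z) in
      1≉0 (trans (sym (pair-P P≢⊥)) (minBalanced-vanish min (pair-nonneg Z) pair-supp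
        (1# , total-pair Z) S∈ (pair-≢ S≢Z S≢∁Z) Z))
      where
      pair-supp : Supported 𝓑 (pair Z)
      pair-supp S S∉ = pair-≢ {P = Z} {S} (λ { refl → S∉ Z∈ }) (λ { refl → S∉ ∁Z∈ })

    ∈⇒≢∁Z : ∀ {S} → S ∈ˢ 𝓑 → S ≢ ∁ Z
    ∈⇒≢∁Z S∈ refl = ∁Z∉ S∈

    forward-∁Z<0 : forward μ (∁ Z) < 0#
    forward-∁Z<0 = <-respˡ-≈ (sym (clear-off Z Z μ (pair-∁P P≢⊥) (μ-supp (∁ Z) ∁Z∉))) (pos⇒-neg (μ>0 Z Z∈))

    forward>0 : ∀ S → S ∈ˢ 𝓢 → S ≢ ∁ Z → 0# < forward μ S
    forward>0 S S∈ S≢∁Z = let S∈𝓑 , S≢Z = ∈-other S∈ S≢∁Z in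
      <-respʳ-≈ (sym (clear-≢ Z Z μ S≢Z S≢∁Z)) (μ>0 S S∈𝓑)

    forward<0⇒≡∁Z : ∀ S → S ∈ˢ 𝓢 → forward μ S < 0# → S ≡ ∁ Z
    forward<0⇒≡∁Z S S∈ <0 with S ≟ˢ ∁ Z
    ... | yes S≡∁Z = S≡∁Z
    ... | no  S≢∁Z = contradiction <0 (asym (forward>0 S S∈ S≢∁Z))

    exchange-semiBalanced : SemiBalanced K 𝓢
    exchange-semiBalanced = semiBalanced⁺ nonTrivial
      (λ S T S∈ T∈ S<0 T<0 → ≡.trans (forward<0⇒≡∁Z S S∈ S<0) (≡.sym (forward<0⇒≡∁Z T T∈ T<0)))
      nonZero (forward-supported μ-supp) (clear-constant Z Z μ μ-const)
      where
      nonZero : AllNonZero K 𝓢 (forward μ)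
      nonZero S S∈ with S ≟ˢ ∁ Z
      ... | yes refl = λ ≈0 → irrefl ≈0 forward-∁Z<0
      ... | no S≢∁Z  = pos⇒≉0 (forward>0 S S∈ S≢∁Z)

    -- Carried back to `𝓑`, a combination with constant value can only be a multiple of `μ`.
    -- Minimality, failure of balancedness and uniqueness of the exceptional set are all derived
    -- from this.
    multiple : ∀ {f} → Supported 𝓢 f → Constant f → ∃ λ a → ∀ S → back f S ≈ a * μ S
    multiple {f} f-supp f-const = minBalanced-multiple min μ>0 μ-supp μ-const
      (back-supported f-supp) (clear-constant Z (∁ Z) f f-const)

    exchange-minimal : ∀ 𝓣 → 𝓣 ⊂ˢ 𝓢 → ¬ SemiBalanced K 𝓣
    exchange-minimal 𝓣 𝓣⊂ semi@((nonempty , _) , _) =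
      let f , f≉0 , f-supp , f-const = semiBalanced⁻ semi
          a , f≈aμ = multiple (λ S S∉ → f-supp S (S∉ ∘ proj₁ 𝓣⊂)) f-const
      in ⊂-exchange-vanish {𝓣} 𝓣⊂ (vanish f≈aμ) f≉0 f-supp nonempty
      where
      -- A zero at one member forces the factor `a` to be zero, because `μ` is positive there.
      vanish : ∀ {f : Subset n → Carrier} {a} → (∀ S → f S ≈ a * μ S) →
               ∀ {T} → T ∈ˢ 𝓑 → f T ≈ 0# → ∀ S → f S ≈ 0#
      vanish {f} {a} f≈aμ {T} T∈ fT≈0 S = trans (f≈aμ S) (trans (*-congʳ a≈0) (zeroˡ _))
        where
        a≈0 : a ≈ 0#
        a≈0 = begin
          a                     ≈⟨ *-identityʳ a ⟨
          a * 1#                ≈⟨ *-congˡ (⁻¹-inverseʳ (pos⇒≉0 (μ>0 T T∈))) ⟨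
          a * (μ T * μ T ⁻¹)    ≈⟨ *-assoc a _ _ ⟨
          a * μ T * μ T ⁻¹      ≈⟨ *-congʳ (trans (sym (f≈aμ T)) fT≈0) ⟩
          0# * μ T ⁻¹           ≈⟨ zeroˡ _ ⟩
          0#                    ∎

    -- A positive combination on `𝓢` would be carried back to one that is negative at `Z` and
    -- positive at any other member of `𝓑`, whereas a multiple of `μ` has the same sign at both.
    exchange-not-balanced : ¬ Balanced K 𝓢
    exchange-not-balanced bal =
      let f , f>0 , f-supp , f≈1 = balanced⁻ bal
          a , f≈aμ = multiple f-supp (1# , f≈1)
          -- Only `Z` has to be avoided, so it is passed twice.
          S , S∈ , S≢Z , _ = third-member 𝓑 3≤∣𝓑∣ Z Z
          S≢∁Z = ∈⇒≢∁Z S∈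
      in asym (f>0 S (inj₁ (S∈ , S≢Z ∘ ≡.sym)))
           (<-respˡ-≈ (clear-≢ Z (∁ Z) f S≢Z S≢∁Z) (neg-multiple (μ>0 Z Z∈) (μ>0 S S∈) (f≈aμ Z) (f≈aμ S)
             (<-respˡ-≈ (sym (back-P f-supp)) (pos⇒-neg (f>0 (∁ Z) (inj₂ refl))))))

    exchange-exceptional : Exceptional K 𝓢 (∁ Z)
    exchange-exceptional = exceptional⁺ (inj₂ refl) (forward-supported μ-supp)
      (clear-constant Z Z μ μ-const) forward-∁Z<0 (λ S S∈ S≢∁Z → inj₁ (forward>0 S S∈ S≢∁Z))

    -- If `T` is not `∁ Z`, then `back` leaves the coefficients at `T` and at a third member `S`
    -- unchanged. They have the same sign as parts of a multiple of `μ`, but the one at `T` is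
    -- negative and the one at `S` is not.
    exchange-exceptional-unique : ∀ T → Exceptional K 𝓢 T → T ≡ ∁ Z
    exchange-exceptional-unique T exc with T ≟ˢ ∁ Z
    ... | yes T≡∁Z = T≡∁Z
    ... | no  T≢∁Z =
      let f , f-supp , f-const , fT<0 , f≥0 = exceptional⁻ exc
          a , f≈aμ = multiple f-supp f-const
          T∈ , T≢Z = ∈-other (proj₁ exc) T≢∁Z
          S , S∈ , S≢Z , S≢T = third-member 𝓑 3≤∣𝓑∣ Z T
          S≢∁Z = ∈⇒≢∁Z S∈
      in contradiction
           (neg-multiple (μ>0 T T∈) (μ>0 S S∈)
             (trans (sym (clear-≢ Z (∁ Z) f T≢Z T≢∁Z)) (f≈aμ T))
             (trans (sym (clear-≢ Z (∁ Z) f S≢Z S≢∁Z)) (f≈aμ S)) fT<0)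
           (nonneg⇒≮0 (f≥0 S S≢T))

  -- Balanced systems with fewer than three members.

  -- A point outside `A` must lie in `B` and gives `b` the value 1. A point in both sets would then
  -- yield `a + 1 = 1`, and a point in neither `0 = 1`. The trailing `0#` matches the unfolded sum
  -- over a list of two sets.
  pair-complementary : {A B : Subset n} {a b : Carrier} → A ≢ ⊤ → 0# < a →
    (∀ i → a * χ K A i + (b * χ K B i + 0#) ≈ 1#) → B ≡ ∁ A
  pair-complementary {A = A} {B} {a} {b} A≢⊤ 0<a ab≈1 =
    subset-ext λ i → ≡.trans (opposite i) (≡.sym (lookup-∁ A i))
    where
    0+0≉1 : ¬ (a * 0# + (b * 0# + 0#) ≈ 1#)
    0+0≉1 eq = 1≉0 (begin
      1#                       ≈⟨ eq ⟨
      a * 0# + (b * 0# + 0#)   ≈⟨ +-cong (zeroʳ a) (trans (+-identityʳ _) (zeroʳ b)) ⟩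
      0# + 0#                  ≈⟨ +-identityˡ 0# ⟩
      0#                       ∎)
    b≈1 : b ≈ 1#
    b≈1 with i , i∈∁A ← ≢⊥⇒inhabited (∁≢⊥ A≢⊤)
      with Vec.lookup A i | Vec.lookup B i | ab≈1 i | ≡.trans (≡.sym i∈∁A) (lookup-∁ A i)
    ... | false | false | eq | _ = contradiction eq 0+0≉1
    ... | false | true  | eq | _ = begin
      b                        ≈⟨ *-identityʳ b ⟨
      b * 1#                   ≈⟨ +-identityʳ _ ⟨
      b * 1# + 0#              ≈⟨ +-identityˡ _ ⟨
      0# + (b * 1# + 0#)       ≈⟨ +-congʳ (zeroʳ a) ⟨
      a * 0# + (b * 1# + 0#)   ≈⟨ eq ⟩
      1#                       ∎
    1+1≉1 : ¬ (a * 1# + (b * 1# + 0#) ≈ 1#)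
    1+1≉1 eq = irrefl (begin
      0# + 1#                  ≈⟨ +-identityˡ 1# ⟩
      1#                       ≈⟨ eq ⟨
      a * 1# + (b * 1# + 0#)
        ≈⟨ +-cong (*-identityʳ a) (trans (+-identityʳ _) (trans (*-identityʳ b) b≈1)) ⟩
      a + 1#                   ∎) (+-monoˡ-< 1# 0<a)
    opposite : ∀ i → Vec.lookup B i ≡ not (Vec.lookup A i)
    opposite i with Vec.lookup A i | Vec.lookup B i | ab≈1 i
    ... | true  | false | _  = refl
    ... | false | true  | _  = refl
    ... | true  | true  | eq = contradiction eq 1+1≉1
    ... | false | false | eq = contradiction eq 0+0≉1

  -- If `Z` were the only member, the combination would be zero at a point outside `Z`. If there
  -- were one further member, it would have to be `∁ Z`.
  balanced⇒3≤ : {𝓑 : SetSystem n} {Z : Subset n} → Balanced K 𝓑 → Z ∈ˢ 𝓑 → ∁ Z ∉ˢ 𝓑 → 3 ≤ ∣ 𝓑 ∣ˢ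
  balanced⇒3≤ {n} {𝓑} {Z} ((_ , _ , ⊤∉) , f , f≥0 , f≉0 , f≈χ) Z∈ ∁Z∉ =
    go (members 𝓑) (∈-members⁺ 𝓑 Z∈) (∈-members⁻ 𝓑) λ i → trans (f≈χ i) (χ-⊤ i)
    where
    Z≢⊤ : Z ≢ ⊤
    Z≢⊤ refl = ⊤∉ Z∈
    0<fZ : 0# < f Z
    0<fZ = nonneg∧≉0⇒pos (f≥0 Z Z∈) (f≉0 Z Z∈)
    complement-absent : ∀ {S} → S ∈ˢ 𝓑 → ¬ (∀ i → f Z * χ K Z i + (f S * χ K S i + 0#) ≈ 1#)
    complement-absent {S} S∈ eq = ∁Z∉ (subst (_∈ˢ 𝓑) (pair-complementary {A = Z} {S} Z≢⊤ 0<fZ eq) S∈)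
    go : ∀ xs → Z ∈ xs → (∀ {S} → S ∈ xs → S ∈ˢ 𝓑) → (∀ i → comb xs f i ≈ 1#) → 3 ≤ length xs
    go (_ ∷ []) (here refl) _ eq with i , i∈∁Z ← ≢⊥⇒inhabited (∁≢⊥ Z≢⊤)
      with Vec.lookup Z i | eq i | ≡.trans (≡.sym i∈∁Z) (lookup-∁ Z i)
    ... | false | eq-i | _ =
      contradiction (trans (sym eq-i) (trans (+-identityʳ _) (zeroʳ _))) 1≉0
    go (_ ∷ S ∷ []) (here refl) ∈𝓑 eq = contradiction eq (complement-absent (∈𝓑 (there (here refl))))
    go (S ∷ _ ∷ []) (there (here refl)) ∈𝓑 eq =
      contradiction (λ i → trans (x∙yz≈y∙xz _ _ _) (eq i)) (complement-absent (∈𝓑 (here refl)))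
    go (_ ∷ _ ∷ _ ∷ _) _ _ _ = s≤s (s≤s (s≤s z≤n))

  -- From min-semi-balanced to min-balanced systems.

  module FromMinSemiBalanced {𝓢 : SetSystem n} {Y : Subset n}
    (min : MinSemiBalanced K 𝓢) (exc : Exceptional K 𝓢 Y) where

    Y∈ : Y ∈ˢ 𝓢
    Y∈ = proj₁ exc

    open Exchange {𝓠 = 𝓢} (proj₁ (proj₁ min)) Y∈

    𝓑 : SetSystem n
    𝓑 = exchange 𝓢 Y

    private
      exceptional = exceptional⁻ exc
      μ           = proj₁ exceptional
      μ-supp      = proj₁ (proj₂ exceptional)
      μ-const     = proj₁ (proj₂ (proj₂ exceptional))
      μY<0        = proj₁ (proj₂ (proj₂ (proj₂ exceptional)))
      μ≥0         = proj₂ (proj₂ (proj₂ (proj₂ exceptional)))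

    -- With `Y` as the only possible place of a negative coefficient, `f` is semi-conic and
    -- minimality applies.
    vanish : ∀ {f} → (∀ S → S ≢ Y → 0# ≼ f S) → Supported 𝓢 f → Constant f →
             ∀ {T} → T ∈ˢ 𝓢 → f T ≈ 0# → ∀ S → f S ≈ 0#
    vanish {f} f≥0 = minSemiBalanced-vanish min
      λ S T fS<0 fT<0 → ≡.trans (neg⇒≡Y S fS<0) (≡.sym (neg⇒≡Y T fT<0))
      where
      neg⇒≡Y : ∀ S → f S < 0# → S ≡ Y
      neg⇒≡Y S fS<0 with S ≟ˢ Y
      ... | yes S≡Y = S≡Y
      ... | no  S≢Y = contradiction fS<0 (nonneg⇒≮0 (f≥0 S S≢Y))

    -- A zero at a member would make `μ` vanish at `Y` as well, where it is negative.
    μ>0 : ∀ S → S ∈ˢ 𝓢 → S ≢ Y → 0# < μ S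
    μ>0 S S∈ S≢Y = nonneg∧≉0⇒pos (μ≥0 S S≢Y)
      λ μS≈0 → irrefl (vanish μ≥0 μ-supp μ-const S∈ μS≈0 Y) μY<0

    -- The coefficient is `μ (∁ Y) - μ Y`. Only non-negativity of `μ (∁ Y)` is used, so the bound is
    -- available for showing that `∁ Y` is not a member.
    forward-∁Y>0 : 0# < forward μ (∁ Y)
    forward-∁Y>0 = <-respʳ-≈ (sym (clear-pair Y Y μ (pair-∁P P≢⊥)))
      (+-nonneg-pos (μ≥0 (∁ Y) (P≢∁P ∘ ≡.sym)) (neg⇒-pos μY<0))

    forward≥0 : ∀ S → S ≢ Y → 0# ≼ forward μ S
    forward≥0 S S≢Y with S ≟ˢ ∁ Y
    ... | yes refl = inj₁ forward-∁Y>0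
    ... | no S≢∁Y  = ≼-respʳ-≈ (sym (clear-≢ Y Y μ S≢Y S≢∁Y)) (μ≥0 S S≢Y)

    -- If `∁ Y` were a member, `forward μ` would be a combination on `𝓢` itself that is zero at `Y`,
    -- non-negative elsewhere and positive at `∁ Y`, against minimality.
    ∁Y∉ : ∁ Y ∉ˢ 𝓢
    ∁Y∉ ∁Y∈ = pos⇒≉0 forward-∁Y>0
      (vanish forward≥0 forward-supp (clear-constant Y Y μ μ-const) Y∈ (clear-X Y Y μ (pair-P P≢⊥)) (∁ Y))
      where
      forward-supp : Supported 𝓢 (forward μ)
      forward-supp S S∉ =
        trans (clear-≢ Y Y μ (λ { refl → S∉ Y∈ }) (λ { refl → S∉ ∁Y∈ })) (μ-supp S S∉)

    exchange-balanced : Balanced K 𝓑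
    exchange-balanced = balanced⁺ nonTrivial positive (forward-supported μ-supp) (clear-constant Y Y μ μ-const)
      where
      positive : Positive 𝓑 (forward μ)
      positive S S∈ with S ≟ˢ ∁ Y
      ... | yes refl = forward-∁Y>0
      ... | no S≢∁Y  = let S∈𝓢 , S≢Y = ∈-other S∈ S≢∁Y in
                       <-respʳ-≈ (sym (clear-≢ Y Y μ S≢Y S≢∁Y)) (μ>0 S S∈𝓢 S≢Y)

    -- A conic combination on a strict subsystem, carried back to `𝓢`, can be negative only at `Y`.
    -- It is therefore semi-conic, and the minimality of `𝓢` makes it vanish.
    exchange-minimal : ∀ 𝓣 → 𝓣 ⊂ˢ 𝓑 → ¬ Balanced K 𝓣
    exchange-minimal 𝓣 𝓣⊂ bal@((nonempty , _) , _) =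
      let f , f>0 , f-supp𝓣 , f≈1 = balanced⁻ bal
          f-supp = λ S S∉ → f-supp𝓣 S (S∉ ∘ proj₁ 𝓣⊂)
          f≥0 = supported-nonneg 𝓣 f-supp𝓣 (λ S → inj₁ ∘ f>0 S)
      in ⊂-exchange-vanish {𝓣} 𝓣⊂
           (vanish (back≥0 f≥0) (back-supported f-supp) (clear-constant Y (∁ Y) f (1# , f≈1)))
           (λ S → pos⇒≉0 ∘ f>0 S) f-supp𝓣 nonempty
      where
      back≥0 : ∀ {f} → (∀ S → 0# ≼ f S) → ∀ S → S ≢ Y → 0# ≼ back f S
      back≥0 {f} f≥0 S S≢Y with S ≟ˢ ∁ Y
      ... | yes refl = ≈0⇒nonneg (clear-X Y (∁ Y) f (pair-∁P P≢⊥))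
      ... | no S≢∁Y  = ≼-respʳ-≈ (sym (clear-≢ Y (∁ Y) f S≢Y S≢∁Y)) (f≥0 S)

    exchange-3≤ : 3 ≤ ∣ 𝓑 ∣ˢ
    -- The bound is applied to the member `∁ Y`, whose complement `Y` has been removed.
    exchange-3≤ = balanced⇒3≤ exchange-balanced (inj₂ refl)
      (subst (_∉ˢ 𝓑) (≡.sym (∁-involutive Y)) P∉exchange)

lemma13 : ∀ {c ℓ₁ ℓ₂} (K : OrderedField c ℓ₁ ℓ₂) (n : ℕ) → 3 ≤ n →
    (∀ (𝓑 : SetSystem n) (Z : Subset n) →
    MinBalanced K 𝓑 → 3 ≤ ∣ 𝓑 ∣ˢ → Z ∈ˢ 𝓑 →
    ∁ Z ∉ˢ 𝓑
    × PurelyMinSemiBalanced K ((𝓑 ∖ˢ ｛ Z ｝ˢ) ∪ˢ ｛ ∁ Z ｝ˢ)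
    × UniqueExceptional K ((𝓑 ∖ˢ ｛ Z ｝ˢ) ∪ˢ ｛ ∁ Z ｝ˢ) (∁ Z))
    ×
    (∀ (𝓢 : SetSystem n) (Y : Subset n) →
    MinSemiBalanced K 𝓢 → Exceptional K 𝓢 Y →
    ∁ Y ∉ˢ 𝓢
    × MinBalanced K ((𝓢 ∖ˢ ｛ Y ｝ˢ) ∪ˢ ｛ ∁ Y ｝ˢ)
    × 3 ≤ ∣ (𝓢 ∖ˢ ｛ Y ｝ˢ) ∪ˢ ｛ ∁ Y ｝ˢ ∣ˢ)
lemma13 K n _ =
  (λ 𝓑 Z min 3≤∣𝓑∣ Z∈ → let open FromMinBalanced K min 3≤∣𝓑∣ Z∈ in
    ∁Z∉ ,
    ((exchange-semiBalanced , exchange-minimal) , exchange-not-balanced) ,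
    (exchange-exceptional , exchange-exceptional-unique)) ,
  (λ 𝓢 Y min exc → let open FromMinSemiBalanced K min exc in
    ∁Y∉ , (exchange-balanced , exchange-minimal) , exchange-3≤)
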